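{- Let $n\ge 1$ and let the edges of the complete graph $K_n$ be colored arbitrarily with two colors, red and blue. Then there is a monochromatic diameter two subgraph $H$ of $K_n$ with $|V(H)|\ge \lceil 3n/4\rceil$. Moreover, there exist red/blue colorings of the edges of $K_n$ for which the largest monochromatic diameter two subgraph has exactly $\lceil 3n/4\rceil$ vertices.
   Context: A subgraph $H$ of an edge-colored complete graph is monochromatic if all edges of $H$ have the same color. A graph $H$ has diameter two (is a diameter two subgraph) if for every pair of vertices $x,y$ of $H$ there is a path in $H$ joining $x$ and $y$ containing at most two edges. The size of a subgraph is its number of vertices. -}

module Defs where

open import Data.Nat using (ℕ; _+_; _*_)
open import Data.Nat.DivMod using (_/_)
open import Data.Fin using (Fin)
open import Data.Fin.Subset using (Subset; _∈_; ∣_∣)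
open import Data.Product using (_×_; Σ; ∃-syntax)
open import Data.Sum using (_⊎_)
open import Relation.Binary.PropositionalEquality using (_≡_; _≢_)

data Colour : Set where
  red blue : Colour

-- a red/blue colouring of the edges of K_n (vertex set Fin n):
-- a symmetric colour function; its value on the diagonal is irrelevant
record Colouring (n : ℕ) : Set where
  field
    col  : Fin n → Fin n → Colour
    symm : ∀ x y → col x y ≡ col y x
open Colouring public

record Subgraph (n : ℕ) : Set₁ where
  field
    V        : Subset n
    E        : Fin n → Fin n → Set
    E-inV    : ∀ {x y} → E x y → x ∈ V × y ∈ V
    E-irrefl : ∀ {x y} → E x y → x ≢ y
    E-symm   : ∀ {x y} → E x y → E y x
open Subgraph public

size : ∀ {n} → Subgraph n → ℕ
size H = ∣ V H ∣

Monochromatic : ∀ {n} → Colouring n → Colour → Subgraph n → Set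
Monochromatic c k H = ∀ {x y} → E H x y → col c x y ≡ k

DiameterTwo : ∀ {n} → Subgraph n → Set
DiameterTwo H = ∀ x y → x ∈ V H → y ∈ V H →
  x ≡ y ⊎ E H x y ⊎ ∃[ z ] (E H x z × E H z y)

MonoDiam2 : ∀ {n} → Colouring n → Subgraph n → Set
MonoDiam2 c H = Σ Colour (λ k → Monochromatic c k H) × DiameterTwo H

ceil3n/4 : ℕ → ℕ
ceil3n/4 n = (3 * n + 3) / 4

{-# OPTIONS --safe #-}

-- Call a pair far for colour k and a set W if it does not have colour k and
-- has no common k-neighbour in W. A larger W has
-- fewer far pairs, so a monotone fixpoint gives sets U, W such that U consists
-- of the ends of the red-far pairs relative to W and W of the ends of the
-- blue-far pairs relative to U; they are disjoint.
-- Without blue-far pairs everything has blue diameter two; otherwise such a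
-- pair u, v splits U: no vertex of U is blue to both u and v,
-- so a red-far pair has one end red to u and the other not. Removing either
-- part of U leaves W intact and destroys all red-far pairs, so the rest has
-- red diameter two. W splits likewise, and the smallest of the four disjoint
-- parts has at most n/4 vertices.
module Submission where

open import Defs
open import Data.Nat using (ℕ; suc; _+_; _*_; _∸_; _≤_; _≥_; z≤n; s≤s; s≤s⁻¹; ∣_-_∣; _≤ᵇ_)
open import Data.Nat.Properties
  using (≤-trans; ≤-reflexive; ≤-antisym; ≤-total; +-suc; +-comm; +-identityʳ; +-mono-≤; +-monoʳ-≤;
         +-monoˡ-≤; *-comm; *-assoc; *-monoʳ-≤; *-distribˡ-∸; m+n≤o⇒m≤o∸n; m≤n+o⇒m∸n≤o; ∣-∣-comm;
         module ≤-Reasoning)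
open import Data.Nat.DivMod using (_/_; m<n*o⇒m/o<n; /-monoˡ-≤; m*n/n≡m)
open import Data.Nat.Tactic.RingSolver using (solve-∀)
open import Data.Bool using (if_then_else_)
open import Data.Fin using (Fin; suc; toℕ)
open import Data.Fin.Patterns using (0F; 1F; 2F; 3F)
open import Data.Fin.Properties using (_≟_; any?; all?)
open import Data.Fin.Subset using (Subset; _∈_; _∉_; _⊆_; _⊃_; _∪_; ∣_∣; ∁; ⊥; inside; outside)
open import Data.Fin.Subset.Properties
  using (_∈?_; _⊆?_; ⊆-antisym; ∉⊥; ⊥⊆; x∈p∪q⁻; p⊆q⇒∣p∣≤∣q∣; ∣p∣≤n; ∣∁p∣≡n∸∣p∣; x∈∁p⇒x∉p; x∉p⇒x∈∁p)
open import Data.Fin.Subset.Induction using (⊃-wellFounded)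
open import Data.Vec using (_∷_; []; here; there; tabulate)
open import Data.Vec.Properties using (lookup∘tabulate; lookup⇒[]=; []=⇒lookup)
open import Data.Product using (_×_; _,_; ∃-syntax; proj₁; proj₂)
open import Data.Sum using (_⊎_; inj₁; inj₂; [_,_]′)
open import Function using (_∘_; case_of_)
open import Induction.WellFounded using (Acc; acc)
open import Relation.Binary.PropositionalEquality using (_≡_; _≢_; refl; sym; trans; cong; subst)
open import Relation.Nullary using (¬_; Dec; yes; no; does; contradiction; _×-dec_; ¬?)
open import Relation.Nullary.Decidable using (dec-true; from-yes; decidable-stable)
open import Relation.Unary using (Decidable)

private
  variable
    n : ℕ

-- Finite subsets: counting and fixpoints.

⟪_⟫ : {P : Fin n → Set} → Decidable P → Subset n
⟪ P? ⟫ = tabulate (does ∘ P?)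

∈⟪⟫⁺ : {P : Fin n → Set} (P? : Decidable P) → ∀ {x} → P x → x ∈ ⟪ P? ⟫
∈⟪⟫⁺ P? {x} px =
  lookup⇒[]= x _ (trans (lookup∘tabulate (does ∘ P?) x) (dec-true (P? x) px))

∈⟪⟫⁻ : {P : Fin n → Set} (P? : Decidable P) → ∀ {x} → x ∈ ⟪ P? ⟫ → P x
∈⟪⟫⁻ P? {x} x∈ with P? x | trans (sym (lookup∘tabulate (does ∘ P?) x)) ([]=⇒lookup x∈)
... | yes px | _ = px

Disjoint : Subset n → Subset n → Set
Disjoint p q = ∀ {x} → x ∈ p → x ∉ q

∣p∪q∣≡∣p∣+∣q∣ : (p q : Subset n) → Disjoint p q → ∣ p ∪ q ∣ ≡ ∣ p ∣ + ∣ q ∣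
∣p∪q∣≡∣p∣+∣q∣ []            []            p#q = refl
∣p∪q∣≡∣p∣+∣q∣ (outside ∷ p) (outside ∷ q) p#q =
  ∣p∪q∣≡∣p∣+∣q∣ p q λ x∈p x∈q → p#q (there x∈p) (there x∈q)
∣p∪q∣≡∣p∣+∣q∣ (outside ∷ p) (inside  ∷ q) p#q =
  trans (cong suc (∣p∪q∣≡∣p∣+∣q∣ p q λ x∈p x∈q → p#q (there x∈p) (there x∈q)))
        (sym (+-suc ∣ p ∣ ∣ q ∣))
∣p∪q∣≡∣p∣+∣q∣ (inside  ∷ p) (outside ∷ q) p#q =
  cong suc (∣p∪q∣≡∣p∣+∣q∣ p q λ x∈p x∈q → p#q (there x∈p) (there x∈q))
∣p∪q∣≡∣p∣+∣q∣ (inside  ∷ p) (inside  ∷ q) p#q = contradiction here (p#q here)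

disjoint⇒∣p∣+∣q∣≤∣r∣ : {p q r : Subset n} → Disjoint p q → p ⊆ r → q ⊆ r → ∣ p ∣ + ∣ q ∣ ≤ ∣ r ∣
disjoint⇒∣p∣+∣q∣≤∣r∣ {p = p} {q} p#q p⊆r q⊆r =
  subst (_≤ _) (∣p∪q∣≡∣p∣+∣q∣ p q p#q)
        (p⊆q⇒∣p∣≤∣q∣ λ x∈ → [ p⊆r , q⊆r ]′ (x∈p∪q⁻ p q x∈))

disjoint⇒∣p∣+∣q∣≤n : {p q : Subset n} → Disjoint p q → ∣ p ∣ + ∣ q ∣ ≤ n
disjoint⇒∣p∣+∣q∣≤n {p = p} {q} p#q =
  subst (_≤ _) (∣p∪q∣≡∣p∣+∣q∣ p q p#q) (∣p∣≤n (p ∪ q))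

half : ∀ a b {c} → a + b ≤ c → 2 * a ≤ c ⊎ 2 * b ≤ c
half a b a+b≤c with ≤-total a b
... | inj₁ a≤b = inj₁ (≤-trans (+-monoʳ-≤ a (+-monoˡ-≤ 0 a≤b)) a+[b+0]≤c)
  where
  a+[b+0]≤c = subst (λ m → a + m ≤ _) (sym (+-identityʳ b)) a+b≤c
... | inj₂ b≤a = inj₂ (≤-trans (+-mono-≤ b≤a (≤-reflexive (+-identityʳ b))) a+b≤c)

-- Iterating `F` from `⊥` gives an ascending chain, which stops because `⊃` is well-founded on
-- subsets of a finite set.
monotone⇒fixpoint : (F : Subset n → Subset n) → (∀ {p q} → p ⊆ q → F p ⊆ F q) → ∃[ p ] F p ≡ p
monotone⇒fixpoint F mono = go ⊥ ⊥⊆ (⊃-wellFounded ⊥)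
  where
  go : ∀ p → p ⊆ F p → Acc _⊃_ p → ∃[ q ] F q ≡ q
  go p p⊆Fp (acc rec) with F p ⊆? p
  ... | yes Fp⊆p = p , ⊆-antisym Fp⊆p p⊆Fp
  -- A strict inclusion needs an explicit new element; a finite search supplies it.
  ... | no  Fp⊈p with any? (λ x → (x ∈? F p) ×-dec ¬? (x ∈? p))
  ...   | yes new = go (F p) (mono p⊆Fp) (rec (p⊆Fp , new))
  ...   | no none = contradiction
            (λ {x} x∈Fp → decidable-stable (x ∈? p) λ x∉p → none (x , x∈Fp , x∉p)) Fp⊈p

-- Two colours and far pairs.

_≟ᶜ_ : (k l : Colour) → Dec (k ≡ l)
red  ≟ᶜ red  = yes refl
red  ≟ᶜ blue = no λ ()
blue ≟ᶜ red  = no λ ()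
blue ≟ᶜ blue = yes refl

third-colour : ∀ {k l m : Colour} → k ≢ l → m ≢ k → m ≡ l
third-colour {red}  {red}          k≢l m≢k = contradiction refl k≢l
third-colour {blue} {blue}         k≢l m≢k = contradiction refl k≢l
third-colour {red}  {blue} {red}   k≢l m≢k = contradiction refl m≢k
third-colour {red}  {blue} {blue}  k≢l m≢k = refl
third-colour {blue} {red}  {red}   k≢l m≢k = refl
third-colour {blue} {red}  {blue}  k≢l m≢k = contradiction refl m≢k

module _ (c : Colouring n) where

  -- The diagonal of `col` is arbitrary, so distinctness is demanded separately.
  Adj : Colour → Fin n → Fin n → Set
  Adj k x y = x ≢ y × col c x y ≡ k

  adj? : ∀ k x y → Dec (Adj k x y)
  adj? k x y = ¬? (x ≟ y) ×-dec (col c x y ≟ᶜ k)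

  Adj-sym : ∀ {k x y} → Adj k x y → Adj k y x
  Adj-sym (x≢y , xy) = x≢y ∘ sym , trans (symm c _ _) xy

  -- Only the midpoint is confined to `W`; the ends range over all vertices.
  Linked : Colour → Subset n → Fin n → Fin n → Set
  Linked k W x y = ∃[ z ] (z ∈ W × Adj k x z × Adj k z y)

  linked? : ∀ k W x y → Dec (Linked k W x y)
  linked? k W x y = any? λ z → (z ∈? W) ×-dec (adj? k x z ×-dec adj? k z y)

  Linked-sym : ∀ {k W x y} → Linked k W x y → Linked k W y x
  Linked-sym (z , z∈W , xz , zy) = z , z∈W , Adj-sym zy , Adj-sym xz

  Far : Colour → Subset n → Fin n → Fin n → Set
  Far k W x y = x ≢ y × col c x y ≢ k × ¬ Linked k W x y

  far? : ∀ k W x y → Dec (Far k W x y)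
  far? k W x y = ¬? (x ≟ y) ×-dec (¬? (col c x y ≟ᶜ k) ×-dec ¬? (linked? k W x y))

  Far-sym : ∀ {k W x y} → Far k W x y → Far k W y x
  Far-sym (x≢y , xy≢k , ¬l) = x≢y ∘ sym , xy≢k ∘ trans (symm c _ _) , ¬l ∘ Linked-sym

  hasFar? : ∀ k W x → Dec (∃[ y ] Far k W x y)
  hasFar? k W x = any? (far? k W x)

  farSet : Colour → Subset n → Subset n
  farSet k W = ⟪ hasFar? k W ⟫

  farSet⁺ : ∀ {k W x y} → Far k W x y → x ∈ farSet k W
  farSet⁺ {k} {W} f = ∈⟪⟫⁺ (hasFar? k W) (_ , f)

  farSet⁻ : ∀ {k W x} → x ∈ farSet k W → ∃[ y ] Far k W x y
  farSet⁻ {k} {W} = ∈⟪⟫⁻ (hasFar? k W)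

  farSet-antitone : ∀ k {W W′} → W ⊆ W′ → farSet k W′ ⊆ farSet k W
  farSet-antitone k W⊆W′ x∈ with farSet⁻ x∈
  ... | y , x≢y , xy≢k , ¬l =
    farSet⁺ (x≢y , xy≢k , λ (z , z∈W , adj) → ¬l (z , W⊆W′ z∈W , adj))

  Diam2 : Colour → Subset n → Set
  Diam2 k S = ∀ {x y} → x ∈ S → y ∈ S → x ≡ y ⊎ Adj k x y ⊎ Linked k S x y

  HasDiam2 : Subset n → Set
  HasDiam2 S = ∃[ k ] Diam2 k S

  -- Midpoints are taken from `W`, which survives the removal of `X`, so every link persists inside
  -- `∁ X`.
  ∁-diam2 : ∀ {k W X} → Disjoint W X → (∀ {x y} → x ∉ X → y ∉ X → ¬ Far k W x y) → Diam2 k (∁ X)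
  ∁-diam2 {k} {W} W#X near {x} {y} x∈ y∈ with x ≟ y | col c x y ≟ᶜ k | linked? k W x y
  ... | yes x≡y | _      | _ = inj₁ x≡y
  ... | no x≢y  | yes xy | _ = inj₂ (inj₁ (x≢y , xy))
  ... | no x≢y  | no _   | yes (z , z∈W , adj) = inj₂ (inj₂ (z , x∉p⇒x∈∁p (W#X z∈W) , adj))
  ... | no x≢y  | no xy≢k | no ¬l =
    contradiction (x≢y , xy≢k , ¬l) (near (x∈∁p⇒x∉p x∈) (x∈∁p⇒x∉p y∈))

  -- Stable pairs of sets and a small removable part.

  module Stable {k l U W} (k≢l : k ≢ l) (U≡ : farSet k W ≡ U) (W≡ : farSet l U ≡ W) where

    U⁺ : ∀ {x y} → Far k W x y → x ∈ U
    U⁺ f = subst (_ ∈_) U≡ (farSet⁺ f)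

    W⁺ : ∀ {x y} → Far l U x y → x ∈ W
    W⁺ f = subst (_ ∈_) W≡ (farSet⁺ f)

    -- A common vertex `y` has a `k`-far partner `z` in `U` and an `l`-far partner `w` in `W`, with
    -- `yz` of colour `l` and `yw` of colour `k`. If `zw` has colour `k`, then `w` links `y` to `z`;
    -- otherwise `z` links `y` to `w`.
    disjoint : Disjoint U W
    disjoint {y} y∈U y∈W
      with farSet⁻ (subst (y ∈_) (sym U≡) y∈U) | farSet⁻ (subst (y ∈_) (sym W≡) y∈W)
    ... | z , yz@(y≢z , yz≢k , ¬yz) | w , yw@(y≢w , yw≢l , ¬yw) with col c z w ≟ᶜ k
    ...   | yes zw≡k = ¬yz (w , W⁺ (Far-sym yw) , (y≢w , yw≡k) , Adj-sym (z≢w , zw≡k))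
      where
      yw≡k = third-colour (k≢l ∘ sym) yw≢l
      z≢w : z ≢ w
      z≢w refl = yz≢k yw≡k
    ...   | no zw≢k = ¬yw (z , U⁺ (Far-sym yz) , (y≢z , third-colour k≢l yz≢k) , z≢w , third-colour k≢l zw≢k)
      where
      z≢w : z ≢ w
      z≢w refl = yz≢k (third-colour (k≢l ∘ sym) yw≢l)

    split : ∃[ X ] ∃[ Y ] (Disjoint X Y × X ⊆ U × Y ⊆ U × HasDiam2 (∁ X) × HasDiam2 (∁ Y))
    split with any? (hasFar? l U)
    ... | no none = ⊥ , ⊥ , (λ x∈⊥ _ → ∉⊥ x∈⊥) , ⊥⊆ , ⊥⊆ , diam , diam
      where
      diam : HasDiam2 (∁ ⊥)
      diam = l , ∁-diam2 {W = U} (λ _ → ∉⊥) λ _ _ f → none (_ , _ , f)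
    ... | yes (u , v , uv@(_ , _ , ¬uv)) =
      ⟪ X? ⟫ , ⟪ Y? ⟫
      , (λ x∈X x∈Y → proj₂ (∈⟪⟫⁻ Y? x∈Y) (proj₂ (∈⟪⟫⁻ X? x∈X)))
      , proj₁ ∘ ∈⟪⟫⁻ X? , proj₁ ∘ ∈⟪⟫⁻ Y?
      -- Both ends of a `k`-far pair lie in `U`. Outside `X` they would both be `k`-adjacent to `v`,
      -- a midpoint in `W`; outside `Y`, both to `u`.
      , (k , ∁-diam2 (λ z∈W z∈X → disjoint (proj₁ (∈⟪⟫⁻ X? z∈X)) z∈W) λ x∉X y∉X f →
          let x~v = adj-v (U⁺ f) (x∉X ∘ ∈⟪⟫⁺ X? ∘ (U⁺ f ,_))
              y~v = adj-v (U⁺ (Far-sym f)) (y∉X ∘ ∈⟪⟫⁺ X? ∘ (U⁺ (Far-sym f) ,_))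
          in proj₂ (proj₂ f) (v , v∈W , x~v , Adj-sym y~v))
      , (k , ∁-diam2 (λ z∈W z∈Y → disjoint (proj₁ (∈⟪⟫⁻ Y? z∈Y)) z∈W) λ x∉Y y∉Y f →
          let u~x = adj-u (U⁺ f) (x∉Y ∘ ∈⟪⟫⁺ Y? ∘ (U⁺ f ,_))
              u~y = adj-u (U⁺ (Far-sym f)) (y∉Y ∘ ∈⟪⟫⁺ Y? ∘ (U⁺ (Far-sym f) ,_))
          in proj₂ (proj₂ f) (u , u∈W , Adj-sym u~x , u~y))
      where
      X? : Decidable λ x → x ∈ U × col c u x ≡ k
      X? x = (x ∈? U) ×-dec (col c u x ≟ᶜ k)
      Y? : Decidable λ x → x ∈ U × col c u x ≢ k
      Y? x = (x ∈? U) ×-dec ¬? (col c u x ≟ᶜ k)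
      u∈W = W⁺ uv
      v∈W = W⁺ (Far-sym uv)
      U≢W : ∀ {x y} → x ∈ U → y ∈ W → x ≢ y
      U≢W x∈U y∈W refl = disjoint x∈U y∈W
      adj-u : ∀ {x} → x ∈ U → ¬ (col c u x ≢ k) → Adj k u x
      adj-u {x} x∈U ux = U≢W x∈U u∈W ∘ sym , decidable-stable (col c u x ≟ᶜ k) ux
      adj-v : ∀ {x} → x ∈ U → col c u x ≢ k → Adj k x v
      -- If `xv` had colour `l`, then `x` would be an `l`-midpoint in `U` for the `l`-far pair `u`,
      -- `v`.
      adj-v {x} x∈U ux≢k = U≢W x∈U v∈W , third-colour (k≢l ∘ sym) λ xv≡l →
        ¬uv (x , x∈U , (U≢W x∈U u∈W ∘ sym , third-colour k≢l ux≢k) , U≢W x∈U v∈W , xv≡l)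

    small : 2 * ∣ U ∣ ≤ n → ∃[ X ] (HasDiam2 (∁ X) × 4 * ∣ X ∣ ≤ n)
    small 2U≤n =
      let X , Y , X#Y , X⊆U , Y⊆U , dX , dY = split in
      [ (λ 2X≤U → X , dX , quarter ∣ X ∣ 2X≤U) , (λ 2Y≤U → Y , dY , quarter ∣ Y ∣ 2Y≤U) ]′
        (half ∣ X ∣ ∣ Y ∣ (disjoint⇒∣p∣+∣q∣≤∣r∣ X#Y X⊆U Y⊆U))
      where
      quarter : ∀ m → 2 * m ≤ ∣ U ∣ → 4 * m ≤ n
      quarter m 2m≤U = ≤-trans (≤-reflexive (*-assoc 2 2 m)) (≤-trans (*-monoʳ-≤ 2 2m≤U) 2U≤n)

  small-complement : ∃[ X ] (HasDiam2 (∁ X) × 4 * ∣ X ∣ ≤ n)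
  small-complement
    -- Two antitone maps compose to a monotone one.
    with monotone⇒fixpoint (farSet red ∘ farSet blue) (farSet-antitone red ∘ farSet-antitone blue)
  ... | U , U≡ with half ∣ U ∣ ∣ farSet blue U ∣ (disjoint⇒∣p∣+∣q∣≤n (Stable.disjoint (λ ()) U≡ refl))
  -- The hypotheses of `Stable` are symmetric under exchanging the colours together with the sets,
  -- so whichever set has at most half of the vertices can be the one that is split.
  ...   | inj₁ 2U≤n = Stable.small (λ ()) U≡ refl 2U≤n
  ...   | inj₂ 2W≤n = Stable.small (λ ()) refl U≡ 2W≤n

  induced : Colour → Subset n → Subgraph n
  induced k S = record
    { V        = S
    ; E        = λ x y → Adj k x y × x ∈ S × y ∈ S
    ; E-inV    = proj₂
    ; E-irrefl = proj₁ ∘ proj₁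
    ; E-symm   = λ (xy , x∈S , y∈S) → Adj-sym xy , y∈S , x∈S
    }

  induced-MonoDiam2 : ∀ {k S} → Diam2 k S → MonoDiam2 c (induced k S)
  induced-MonoDiam2 {k} {S} d = (k , proj₂ ∘ proj₁) , λ x y x∈S y∈S → case d x∈S y∈S of λ where
    (inj₁ x≡y)                        → inj₁ x≡y
    (inj₂ (inj₁ xy))                  → inj₂ (inj₁ (xy , x∈S , y∈S))
    (inj₂ (inj₂ (z , z∈S , xz , zy))) → inj₂ (inj₂ (z , (xz , x∈S , z∈S) , (zy , z∈S , y∈S)))

-- Arithmetic of the ceiling and the lower bound.

ceil3n/4-≤ : ∀ {m} → 4 * m ≤ n → ceil3n/4 n ≤ n ∸ m
ceil3n/4-≤ {n} {m} 4m≤n = s≤s⁻¹ (m<n*o⇒m/o<n (begin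
  suc (3 * n + 3)            ≡⟨ +-suc (3 * n) 3 ⟨
  3 * n + 4                  ≤⟨ +-monoˡ-≤ 4 (m+n≤o⇒m≤o∸n (3 * n) 3n+4m≤4n) ⟩
  (4 * n ∸ 4 * m) + 4        ≡⟨ cong (_+ 4) (*-distribˡ-∸ 4 n m) ⟨
  4 * (n ∸ m) + 4            ≡⟨ +-comm (4 * (n ∸ m)) 4 ⟩
  4 + 4 * (n ∸ m)            ≡⟨ cong (4 +_) (*-comm 4 (n ∸ m)) ⟩
  suc (n ∸ m) * 4            ∎))
  where
  open ≤-Reasoning
  3n+4m≤4n : 3 * n + 4 * m ≤ 4 * n
  3n+4m≤4n = ≤-trans (+-monoʳ-≤ (3 * n) 4m≤n) (≤-reflexive (+-comm (3 * n) n))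

-- The hypothesis says that `m` is at least the floor of `n / 4`, which is `n` minus the ceiling.
≤-ceil3n/4 : ∀ {m} → n ≤ 4 * m + 3 → n ∸ m ≤ ceil3n/4 n
≤-ceil3n/4 {n} {m} n≤4m+3 = begin
  n ∸ m                ≡⟨ m*n/n≡m (n ∸ m) 4 ⟨
  (n ∸ m) * 4 / 4      ≤⟨ /-monoˡ-≤ 4 4n∸4m≤3n+3 ⟩
  (3 * n + 3) / 4      ∎
  where
  open ≤-Reasoning
  rearrange : ∀ a b → a + 3 + b ≡ a + (b + 3)
  rearrange = solve-∀
  4n∸4m≤3n+3 : (n ∸ m) * 4 ≤ 3 * n + 3
  4n∸4m≤3n+3 = begin
    (n ∸ m) * 4      ≡⟨ *-comm (n ∸ m) 4 ⟩
    4 * (n ∸ m)      ≡⟨ *-distribˡ-∸ 4 n m ⟩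
    4 * n ∸ 4 * m    ≤⟨ m≤n+o⇒m∸n≤o (4 * n) (4 * m) (begin
      n + 3 * n               ≤⟨ +-monoˡ-≤ (3 * n) n≤4m+3 ⟩
      4 * m + 3 + 3 * n       ≡⟨ rearrange (4 * m) (3 * n) ⟩
      4 * m + (3 * n + 3)     ∎) ⟩
    3 * n + 3        ∎

large-MonoDiam2 : (c : Colouring n) → ∃[ H ] (MonoDiam2 c H × size H ≥ ceil3n/4 n)
large-MonoDiam2 c =
  let X , (k , d) , 4X≤n = small-complement c in
  induced c k (∁ X) , induced-MonoDiam2 c d
  , ≤-trans (ceil3n/4-≤ {m = ∣ X ∣} 4X≤n) (≤-reflexive (sym (∣∁p∣≡n∸∣p∣ X)))

-- The extremal colouring: a blown-up path on the residues mod 4.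

part : Fin n → Fin 4
part 0F = 0F
part 1F = 1F
part 2F = 2F
part 3F = 3F
part (suc (suc (suc (suc i)))) = part i

class : Fin 4 → Subset n
class j = ⟪ (λ i → part i ≟ j) ⟫

-- Each block of four consecutive vertices adds one vertex to every class; the slack 3 absorbs an
-- incomplete block.
∣class∣ : ∀ n j → n ≤ 4 * ∣ class {n} j ∣ + 3
∣class∣ 0 j = z≤n
∣class∣ 1 j = ≤-trans (s≤s z≤n) (+-monoˡ-≤ 3 z≤n)
∣class∣ 2 j = ≤-trans (s≤s (s≤s z≤n)) (+-monoˡ-≤ 3 z≤n)
∣class∣ 3 j = +-monoˡ-≤ 3 z≤n
∣class∣ (suc (suc (suc (suc n)))) j =
  subst (λ m → 4 + n ≤ 4 * m + 3) (sym (step j))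
    (≤-trans (+-monoʳ-≤ 4 (∣class∣ n j)) (≤-reflexive (rearrange ∣ class {n} j ∣)))
  where
  step : ∀ j → ∣ class {4 + n} j ∣ ≡ suc ∣ class {n} j ∣
  step 0F = refl
  step 1F = refl
  step 2F = refl
  step 3F = refl
  rearrange : ∀ m → 4 + (4 * m + 3) ≡ 4 * suc m + 3
  rearrange = solve-∀

-- The red edges blow up the path 0 - 1 - 2 - 3, the blue ones 2 - 0 - 3 - 1.
pathColour : Fin 4 → Fin 4 → Colour
pathColour a b = if ∣ toℕ a - toℕ b ∣ ≤ᵇ 1 then red else blue

pathColour-sym : ∀ a b → pathColour a b ≡ pathColour b a
pathColour-sym a b rewrite ∣-∣-comm (toℕ a) (toℕ b) = refl

pathColouring : ∀ n → Colouring n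
pathColouring n = record
  { col  = λ x y → pathColour (part x) (part y)
  ; symm = λ x y → pathColour-sym (part x) (part y)
  }

-- Holds for the two ends of the path of colour `k`, which are three steps apart. The midpoint `m`
-- may equal `a` or `b`, since a vertex of `H` between two others may share the class of one of
-- them.
PathEnds : Colour → Fin 4 → Fin 4 → Set
PathEnds k a b =
  a ≢ b × pathColour a b ≢ k × (∀ m → ¬ (pathColour a m ≡ k × pathColour m b ≡ k))

pathEnds : ∀ k → ∃[ a ] ∃[ b ] PathEnds k a b
pathEnds red  = 0F , 3F , (λ ()) , (λ ()) ,
  from-yes (all? λ m → ¬? ((pathColour 0F m ≟ᶜ red) ×-dec (pathColour m 3F ≟ᶜ red)))
pathEnds blue = 1F , 2F , (λ ()) , (λ ()) ,
  from-yes (all? λ m → ¬? ((pathColour 1F m ≟ᶜ blue) ×-dec (pathColour m 2F ≟ᶜ blue)))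

disjoint-class⇒≤ : ∀ {S : Subset n} {j} → Disjoint S (class j) → ∣ S ∣ ≤ ceil3n/4 n
disjoint-class⇒≤ {n} {j = j} S#class =
  ≤-trans (m+n≤o⇒m≤o∸n _ (disjoint⇒∣p∣+∣q∣≤n S#class)) (≤-ceil3n/4 {m = ∣ class {n} j ∣} (∣class∣ n j))

-- `part` projects a path of at most two edges of `H` to a walk on the four classes, which
-- `PathEnds` forbids.
¬both-ends : (H : Subgraph n) (d : MonoDiam2 (pathColouring n) H) → ∀ {x y} →
  x ∈ V H → y ∈ V H → ¬ PathEnds (proj₁ (proj₁ d)) (part x) (part y)
¬both-ends H ((k , mono) , diam) {x} {y} x∈V y∈V (a≢b , ab≢k , ¬amb) =
  case diam x y x∈V y∈V of λ where
    (inj₁ x≡y)                  → a≢b (cong part x≡y)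
    (inj₂ (inj₁ xy))            → ab≢k (mono xy)
    (inj₂ (inj₂ (z , xz , zy))) → ¬amb (part z) (mono xz , mono zy)

-- `H` cannot meet both end classes of its colour, so it misses a whole class.
pathColouring-≤ : (H : Subgraph n) → MonoDiam2 (pathColouring n) H → size H ≤ ceil3n/4 n
pathColouring-≤ H d@((k , _) , _) with pathEnds k
... | a , b , ends with any? (λ x → (x ∈? V H) ×-dec (part x ≟ a))
...   | no none = disjoint-class⇒≤ λ x∈V x∈a → none (_ , x∈V , ∈⟪⟫⁻ (λ i → part i ≟ a) x∈a)
...   | yes (x , x∈V , refl) = disjoint-class⇒≤ λ y∈V y∈b →
  ¬both-ends H d x∈V y∈V
    (subst (PathEnds k (part x)) (sym (∈⟪⟫⁻ (λ i → part i ≟ b) y∈b)) ends)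

theorem1 : (n : ℕ) → n ≥ 1 →
    ((c : Colouring n) → ∃[ H ] (MonoDiam2 c H × size H ≥ ceil3n/4 n))
    × ∃[ c ] ((∃[ H ] (MonoDiam2 c H × size H ≡ ceil3n/4 n))
    × ((H : Subgraph n) → MonoDiam2 c H → size H ≤ ceil3n/4 n))
theorem1 n _ = large-MonoDiam2 , pathColouring n , attained , pathColouring-≤
  where
  attained : ∃[ H ] (MonoDiam2 (pathColouring n) H × size H ≡ ceil3n/4 n)
  attained =
    -- The lower bound for this very colouring meets the upper bound.
    let H , d , large = large-MonoDiam2 (pathColouring n) in
    H , d , ≤-antisym (pathColouring-≤ H d) large
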